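{- Let $\mathcal{G}_d$ be the set of attributed directed graphs and $\mathcal{G}_{\bar d}$ the set of attributed undirected graphs. Then $\mathcal{G}_d\approx\mathcal{G}_{\bar d}$.
   Context: An attributed directed graph is $(V,E,\alpha,\omega)$ with $V\subset\mathbb{N}$, $E\subseteq V\times V$, $\alpha:V\to\mathcal{C}$, $\omega:E\to\mathcal{C}$ for an arbitrary attribute set $\mathcal{C}$. An attributed undirected graph is the same but with edges unordered pairs $\{u,v\}$ of nodes (equivalently a directed graph with $(u,v)\in E$ whenever $(v,u)\in E$). Graph type expressivity: for sets of graphs $\mathcal{G}_1,\mathcal{G}_2$, $\mathcal{G}_1\preccurlyeq\mathcal{G}_2$ means there exists an embedding, i.e. an injective map $\mathcal{G}_1\to\mathcal{G}_2$ (bijective onto its image); $\mathcal{G}_1\approx\mathcal{G}_2$ means both $\mathcal{G}_1\preccurlyeq\mathcal{G}_2$ and $\mathcal{G}_2\preccurlyeq\mathcal{G}_1$. -}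

module Defs where

open import Level using (Level; _⊔_)
open import Data.Nat using (ℕ; _<_)
open import Data.Bool using (Bool; true)
open import Data.Product using (_×_)
open import Relation.Binary.PropositionalEquality using (_≡_)

-- V and E are given by their (Boolean) characteristic functions;
-- finiteness of V is witnessed by a bound.
record DiGraph {ℓ : Level} (C : Set ℓ) : Set ℓ where
  field
    V       : ℕ → Bool
    E       : ℕ → ℕ → Bool
    bound   : ℕ
    bounded : ∀ v → V v ≡ true → v < bound
    E⊆V×V   : ∀ u v → E u v ≡ true → (V u ≡ true) × (V v ≡ true)
    α       : (v : ℕ) → V v ≡ true → C
    ω       : (u v : ℕ) → E u v ≡ true → C

open DiGraph public

record _≈D_ {ℓ : Level} {C : Set ℓ} (G H : DiGraph C) : Set ℓ where
  field
    V≗ : ∀ v → V G v ≡ V H v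
    E≗ : ∀ u v → E G u v ≡ E H u v
    α≗ : ∀ v (p : V G v ≡ true) (q : V H v ≡ true) → α G v p ≡ α H v q
    ω≗ : ∀ u v (p : E G u v ≡ true) (q : E H u v ≡ true) → ω G u v p ≡ ω H u v q

-- An attributed undirected graph: a directed one whose edge set is symmetric
-- and whose edge attributes do not depend on orientation, so that
-- {u,v} ↦ ω(u,v) is a well-defined attribute of the unordered edge {u,v}.
record UGraph {ℓ : Level} (C : Set ℓ) : Set ℓ where
  field
    graph : DiGraph C
    E-sym : ∀ u v → E graph u v ≡ E graph v u
    ω-sym : ∀ u v (p : E graph u v ≡ true) (q : E graph v u ≡ true)
            → ω graph u v p ≡ ω graph v u q

open UGraph public

_≈U_ : {ℓ : Level} {C : Set ℓ} → UGraph C → UGraph C → Set ℓ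
G ≈U H = graph G ≈D graph H

record Embedding {a b ℓ₁ ℓ₂ : Level}
                 (A : Set a) (_≈₁_ : A → A → Set ℓ₁)
                 (B : Set b) (_≈₂_ : B → B → Set ℓ₂)
                 : Set (a ⊔ b ⊔ ℓ₁ ⊔ ℓ₂) where
  field
    to        : A → B
    cong      : ∀ {x y} → x ≈₁ y → to x ≈₂ to y
    injective : ∀ {x y} → to x ≈₂ to y → x ≈₁ y

{-# OPTIONS --safe #-}
module Submission where

open import Defs
open import Level using (Level)
open import Function using (_∘_)
open import Data.Bool using (Bool; true; false)
open import Data.Nat using (ℕ; zero; suc; _+_; _≤_; z≤n; s≤s)
open import Data.Nat.Properties using (+-identityʳ; +-suc; +-comm; +-mono-≤; <⇒≤)
open import Data.Product using (_×_; _,_)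
open import Relation.Binary.PropositionalEquality
open ≡-Reasoning

-- A directed graph G becomes the edgeless undirected graph whose nodes are
-- the codes of the nodes and of the edges of G, labelled by their attributes.
-- Coding pairs by the Cantor pairing keeps the node set finite, and since
-- decoding is a left inverse of the coding, G is recovered from its image.
-- Conversely an undirected graph simply is a directed one.

tri : ℕ → ℕ
tri zero    = zero
tri (suc s) = suc s + tri s

tri-mono : ∀ {m n} → m ≤ n → tri m ≤ tri n
tri-mono z≤n       = z≤n
tri-mono (s≤s m≤n) = +-mono-≤ (s≤s m≤n) (tri-mono m≤n)

pair : ℕ × ℕ → ℕ
pair (u , v) = tri (u + v) + v

pair-mono : ∀ {u v} u′ v′ → u ≤ u′ → v ≤ v′ → pair (u , v) ≤ pair (u′ , v′)
pair-mono _ _ u≤u′ v≤v′ = +-mono-≤ (tri-mono (+-mono-≤ u≤u′ v≤v′)) v≤v′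

-- Successor in the enumeration of ℕ × ℕ along the antidiagonals u + v = s.
next : ℕ × ℕ → ℕ × ℕ
next (zero  , v) = (suc v , zero)
next (suc u , v) = (u , suc v)

unpair : ℕ → ℕ × ℕ
unpair zero    = (zero , zero)
unpair (suc n) = next (unpair n)

pair-next : ∀ x → pair (next x) ≡ suc (pair x)
pair-next (zero , v) = begin
  tri (suc v + 0) + 0  ≡⟨ +-identityʳ _ ⟩
  tri (suc v + 0)      ≡⟨ cong tri (+-identityʳ (suc v)) ⟩
  suc (v + tri v)      ≡⟨ cong suc (+-comm v (tri v)) ⟩
  suc (tri v + v)      ∎
pair-next (suc u , v) = begin
  tri (u + suc v) + suc v  ≡⟨ cong (λ s → tri s + suc v) (+-suc u v) ⟩
  tri (suc u + v) + suc v  ≡⟨ +-suc _ v ⟩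
  suc (tri (suc u + v) + v) ∎

pair-unpair : ∀ n → pair (unpair n) ≡ n
pair-unpair zero    = refl
pair-unpair (suc n) = trans (pair-next (unpair n)) (cong suc (pair-unpair n))

mutual
  unpair-tri : ∀ s → unpair (tri s) ≡ (s , 0)
  unpair-tri zero    = refl
  unpair-tri (suc s) = begin
    next (unpair (s + tri s))  ≡⟨ cong (next ∘ unpair) (+-comm s (tri s)) ⟩
    next (unpair (tri s + s))  ≡⟨ cong next (unpair-antidiagonal s 0 s refl) ⟩
    (suc s , 0)                ∎

  unpair-antidiagonal : ∀ s u v → u + v ≡ s → unpair (tri s + v) ≡ (u , v)
  unpair-antidiagonal s u zero u+0≡s = begin
    unpair (tri s + 0)  ≡⟨ cong unpair (+-identityʳ (tri s)) ⟩
    unpair (tri s)      ≡⟨ unpair-tri s ⟩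
    (s , 0)             ≡⟨ cong (_, 0) (trans (sym u+0≡s) (+-identityʳ u)) ⟩
    (u , 0)             ∎
  unpair-antidiagonal s u (suc v) u+1+v≡s = begin
    unpair (tri s + suc v)    ≡⟨ cong unpair (+-suc (tri s) v) ⟩
    next (unpair (tri s + v)) ≡⟨ cong next (unpair-antidiagonal s (suc u) v (trans (sym (+-suc u v)) u+1+v≡s)) ⟩
    (u , suc v)               ∎

unpair-pair : ∀ x → unpair (pair x) ≡ x
unpair-pair (u , v) = unpair-antidiagonal (u + v) u v refl

∀-unpair : ∀ {p} {P : ℕ × ℕ → Set p} → (∀ n → P (unpair n)) → ∀ x → P x
∀-unpair {P = P} f x = subst P (unpair-pair x) (f (pair x))

module _ {ℓ : Level} {C : Set ℓ} where

  -- (zero , v) stands for the node v of G, and (suc u , v) for its edge (u , v).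
  Item : DiGraph C → ℕ × ℕ → Bool
  Item G (zero  , v) = V G v
  Item G (suc u , v) = E G u v

  attribute : (G : DiGraph C) (x : ℕ × ℕ) → Item G x ≡ true → C
  attribute G (zero  , v) = α G v
  attribute G (suc u , v) = ω G u v

  Item⇒pair≤ : (G : DiGraph C) → ∀ x → Item G x ≡ true → pair x ≤ pair (bound G , bound G)
  Item⇒pair≤ G (zero  , v) v∈V = pair-mono (bound G) (bound G) z≤n (<⇒≤ (bounded G v v∈V))
  Item⇒pair≤ G (suc u , v) uv∈E with E⊆V×V G u v uv∈E
  ... | u∈V , v∈V = pair-mono (bound G) (bound G) (bounded G u u∈V) (<⇒≤ (bounded G v v∈V))

  flatten : DiGraph C → UGraph C
  flatten G = record
    { graph = record
      { V       = Item G ∘ unpair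
      ; E       = λ _ _ → false
      ; bound   = suc (pair (bound G , bound G))
      ; bounded = λ n n∈V → s≤s (subst (_≤ _) (pair-unpair n) (Item⇒pair≤ G (unpair n) n∈V))
      ; E⊆V×V   = λ _ _ ()
      ; α       = attribute G ∘ unpair
      ; ω       = λ _ _ ()
      }
    ; E-sym = λ _ _ → refl
    ; ω-sym = λ _ _ ()
    }

  module _ {G H : DiGraph C} where

    Item-cong : G ≈D H → ∀ x → Item G x ≡ Item H x
    Item-cong G≈H (zero  , v) = _≈D_.V≗ G≈H v
    Item-cong G≈H (suc u , v) = _≈D_.E≗ G≈H u v

    attribute-cong : G ≈D H → ∀ x p q → attribute G x p ≡ attribute H x q
    attribute-cong G≈H (zero  , v) = _≈D_.α≗ G≈H v
    attribute-cong G≈H (suc u , v) = _≈D_.ω≗ G≈H u v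

    flatten-cong : G ≈D H → flatten G ≈U flatten H
    flatten-cong G≈H = record
      { V≗ = Item-cong G≈H ∘ unpair
      ; E≗ = λ _ _ → refl
      ; α≗ = attribute-cong G≈H ∘ unpair
      ; ω≗ = λ _ _ ()
      }

    flatten-injective : flatten G ≈U flatten H → G ≈D H
    flatten-injective FG≈FH = record
      { V≗ = λ v → Item≗ (zero , v)
      ; E≗ = λ u v → Item≗ (suc u , v)
      ; α≗ = λ v → attribute≗ (zero , v)
      ; ω≗ = λ u v → attribute≗ (suc u , v)
      }
      where
      open _≈D_ FG≈FH
      Item≗ : ∀ x → Item G x ≡ Item H x
      Item≗ = ∀-unpair V≗
      attribute≗ : ∀ x p q → attribute G x p ≡ attribute H x q
      attribute≗ = ∀-unpair α≗

lemma6 : {ℓ : Level} (C : Set ℓ)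
    → Embedding (DiGraph C) _≈D_ (UGraph C) _≈U_
    × Embedding (UGraph C) _≈U_ (DiGraph C) _≈D_
lemma6 C = record { to = flatten ; cong = flatten-cong ; injective = flatten-injective }
         , record { to = graph ; cong = λ G≈H → G≈H ; injective = λ G≈H → G≈H }
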